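{- There is a deterministic subcubic reduction from the Zero Weight Triangle Parity problem to the Negative Weight Triangle Parity problem.
   Context: Input graphs have $n$ vertices and integer edge weights in $[-M,M]$, $M=\mathrm{poly}(n)$. A triangle is a set of three pairwise adjacent vertices; its weight is the sum of its three edge weights. Zero Weight Triangle Parity: decide whether the number of triangles of weight exactly $0$ is even or odd. Negative Weight Triangle Parity: decide whether the number of triangles of negative weight is even or odd. A subcubic reduction from P to Q is an algorithm solving P on size-$n$ instances using oracle calls to Q on instances of sizes $n_1,\dots,n_t$ such that for every $\varepsilon>0$ there is $\varepsilon'>0$ with the total time, counting each oracle call of size $n_i$ as $n_i^{3-\varepsilon}$, bounded by $O(n^{3-\varepsilon'})$. -}

module Defs where

open import Data.Fin as Fin using (Fin; toℕ; combine; remQuot)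
import Data.Fin.Properties as Fin
open import Data.Integer as ℤ using (ℤ; +_; 0ℤ; 1ℤ; ∣_∣)
import Data.Integer.Properties as ℤ
open import Data.List.Base
  using (List; []; _∷_; _++_; length; filter; mapMaybe; cartesianProduct; allFin; tabulate; sum)
open import Data.List.Properties using (length-tabulate; mapMaybe-cong)
open import Data.List.Relation.Binary.Pointwise.Base using (Pointwise)
open import Data.Maybe.Base using (Maybe; just; nothing; zipWith)
open import Data.Nat.Base using (ℕ; zero; suc; _+_; _*_; _^_; _∸_; _≤_; _%_; _≡ᵇ_)
import Data.Nat.Properties as ℕ
open import Data.Bool.Base using (if_then_else_)
open import Data.Product using (_×_; _,_; ∃-syntax; proj₁; proj₂; uncurry)
open import Data.Rational.Base using (ℚ; 0ℚ; ↥_; ↧ₙ_) renaming (_<_ to _<ℚ_)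
open import Data.Unit.Base using (⊤; tt)
open import Data.Empty using (⊥-elim)
open import Level using (0ℓ)
open import Relation.Binary.PropositionalEquality
open import Relation.Nullary.Decidable using (_×-dec_)
open import Relation.Unary using (Pred; Decidable)

PolyBounded : (ℕ → ℕ) → Set
PolyBounded f = ∃[ c ] (∀ n → f n ≤ c * n ^ c + c)

Memory : Set
Memory = ℕ → ℤ

Stored : Memory → ℕ → List ℤ → Set
Stored m b []       = ⊤
Stored m b (w ∷ ws) = m b ≡ w × Stored m (suc b) ws

-- `size` is the parameter in which running times are measured (for graph
-- problems the number of vertices), not the length of the encoding.
-- `unambiguous` says that a memory address determines the instance stored
-- there, as far as an oracle can tell.
record Problem : Set₁ where
  field
    Instance    : Set
    size        : Instance → ℕ
    encode      : Instance → List ℤ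
    answer      : Instance → ℤ
    unambiguous : ∀ {m b} x y → Stored m b (encode x) → Stored m b (encode y) →
                  size x ≡ size y × answer x ≡ answer y

open Problem public

Reg : Set
Reg = ℕ

data Op : Set where
  add sub mul : Op

⟦_⟧ : Op → ℤ → ℤ → ℤ
⟦ add ⟧ = ℤ._+_
⟦ sub ⟧ = ℤ._-_
⟦ mul ⟧ = ℤ._*_

infixr 4 _⨾_

-- `load r a` reads into register r the word at the address held in register a;
-- `store a r` writes register r to the address held in register a;
-- `oracle r a` writes to register r the oracle's answer to the instance
-- stored from the address held in register a onwards.
-- The tests of `if` and `while` succeed when the register is positive.
data Program : Set where
  const  : Reg → ℤ → Program
  op     : Op → Reg → Reg → Reg → Program
  load   : Reg → Reg → Program
  store  : Reg → Reg → Program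
  oracle : Reg → Reg → Program
  _⨾_    : Program → Program → Program
  if     : Reg → Program → Program → Program
  while  : Reg → Program → Program

record State : Set where
  constructor ⟨_,_⟩
  field
    reg : Reg → ℤ
    mem : Memory

open State public

_[_↦_] : (ℕ → ℤ) → ℕ → ℤ → (ℕ → ℤ)
(f [ k ↦ v ]) j = if j ≡ᵇ k then v else f j

setReg : Reg → ℤ → State → State
setReg r v s = ⟨ reg s [ r ↦ v ] , mem s ⟩

setMem : ℕ → ℤ → State → State
setMem a v s = ⟨ reg s , mem s [ a ↦ v ] ⟩

-- Exec Q W p s s′ t ns: from state s the program p halts in state s′ after t
-- unit-cost steps and oracle calls to Q on instances of sizes ns (in order).
-- Every word written has absolute value at most W; an execution that would
-- exceed W, use a negative address, or query the oracle on something that does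
-- not encode an instance is stuck.
data Exec (Q : Problem) (W : ℕ) : Program → State → State → ℕ → List ℕ → Set where

  const  : ∀ {r v s} → ∣ v ∣ ≤ W →
           Exec Q W (const r v) s (setReg r v s) 1 []

  op     : ∀ {o r a b s} → let v = ⟦ o ⟧ (reg s a) (reg s b) in ∣ v ∣ ≤ W →
           Exec Q W (op o r a b) s (setReg r v s) 1 []

  load   : ∀ {r a s i} → reg s a ≡ + i → ∣ mem s i ∣ ≤ W →
           Exec Q W (load r a) s (setReg r (mem s i) s) 1 []

  store  : ∀ {a r s i} → reg s a ≡ + i → ∣ reg s r ∣ ≤ W →
           Exec Q W (store a r) s (setMem i (reg s r) s) 1 []

  oracle : ∀ {r a s i} (y : Instance Q) → reg s a ≡ + i →
           Stored (mem s) i (encode Q y) → ∣ answer Q y ∣ ≤ W →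
           Exec Q W (oracle r a) s (setReg r (answer Q y) s) 1 (size Q y ∷ [])

  _⨾_    : ∀ {p₁ p₂ s s′ s″ t₁ t₂ ns₁ ns₂} →
           Exec Q W p₁ s s′ t₁ ns₁ → Exec Q W p₂ s′ s″ t₂ ns₂ →
           Exec Q W (p₁ ⨾ p₂) s s″ (t₁ + t₂) (ns₁ ++ ns₂)

  if-yes : ∀ {r p₁ p₂ s s′ t ns} → 0ℤ ℤ.< reg s r →
           Exec Q W p₁ s s′ t ns →
           Exec Q W (if r p₁ p₂) s s′ (suc t) ns

  if-no  : ∀ {r p₁ p₂ s s′ t ns} → reg s r ℤ.≤ 0ℤ →
           Exec Q W p₂ s s′ t ns →
           Exec Q W (if r p₁ p₂) s s′ (suc t) ns

  while-yes : ∀ {r p s s′ s″ t₁ t₂ ns₁ ns₂} → 0ℤ ℤ.< reg s r →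
              Exec Q W p s s′ t₁ ns₁ → Exec Q W (while r p) s′ s″ t₂ ns₂ →
              Exec Q W (while r p) s s″ (suc (t₁ + t₂)) (ns₁ ++ ns₂)

  while-no  : ∀ {r p s} → reg s r ℤ.≤ 0ℤ →
              Exec Q W (while r p) s s 1 []

deterministic : ∀ {Q W p s s₁ s₂ t₁ t₂ ns₁ ns₂} →
  Exec Q W p s s₁ t₁ ns₁ → Exec Q W p s s₂ t₂ ns₂ →
  s₁ ≡ s₂ × t₁ ≡ t₂ × ns₁ ≡ ns₂
deterministic (const _) (const _) = refl , refl , refl
deterministic (op _) (op _) = refl , refl , refl
deterministic (load e _) (load e′ _)
  with refl ← ℤ.+-injective (trans (sym e) e′) = refl , refl , refl
deterministic (store e _) (store e′ _)
  with refl ← ℤ.+-injective (trans (sym e) e′) = refl , refl , refl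
deterministic {Q} {s = s} (oracle {r} y e st _) (oracle y′ e′ st′ _)
  with refl ← ℤ.+-injective (trans (sym e) e′)
  with n≡ , a≡ ← unambiguous Q y y′ st st′
  = cong (λ v → setReg r v s) a≡ , refl , cong (_∷ []) n≡
deterministic (d₁ ⨾ d₂) (e₁ ⨾ e₂)
  with refl , refl , refl ← deterministic d₁ e₁
  with refl , refl , refl ← deterministic d₂ e₂ = refl , refl , refl
deterministic (if-yes _ d) (if-yes _ e)
  with refl , refl , refl ← deterministic d e = refl , refl , refl
deterministic (if-yes y _) (if-no n _) = ⊥-elim (ℤ.<⇒≱ y n)
deterministic (if-no n _) (if-yes y _) = ⊥-elim (ℤ.<⇒≱ y n)
deterministic (if-no _ d) (if-no _ e)
  with refl , refl , refl ← deterministic d e = refl , refl , refl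
deterministic (while-yes _ d₁ d₂) (while-yes _ e₁ e₂)
  with refl , refl , refl ← deterministic d₁ e₁
  with refl , refl , refl ← deterministic d₂ e₂ = refl , refl , refl
deterministic (while-yes y _ _) (while-no n) = ⊥-elim (ℤ.<⇒≱ y n)
deterministic (while-no n) (while-yes y _ _) = ⊥-elim (ℤ.<⇒≱ y n)
deterministic (while-no _) (while-no _) = refl , refl , refl

contents : List ℤ → Memory
contents []       _       = 0ℤ
contents (w ∷ ws) zero    = w
contents (w ∷ ws) (suc a) = contents ws a

initial : List ℤ → State
initial ws = ⟨ (λ _ → 0ℤ) , contents ws ⟩

record Run (Q : Problem) (W : ℕ) (p : Program) (s : State) : Set where
  field
    final   : State
    steps   : ℕ
    queries : List ℕ
    exec    : Exec Q W p s final steps queries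

open Run public

-- T ≤ C · n^(3 − ε), with both sides raised to the power of the denominator of ε.
-- Truncated subtraction replaces n^(3 − ε) by 1 when ε ≥ 3.
_≤_·_^[3-_] : ℕ → ℕ → ℕ → ℚ → Set
T ≤ C · n ^[3- ε ] = T ^ q ≤ C ^ q * n ^ (3 * q ∸ p)
  where
  p = ∣ ↥ ε ∣
  q = ↧ₙ ε

-- An O(log n)-bit word is one of polynomially bounded absolute value. An oracle
-- call on size nᵢ is charged every natural number cᵢ ≤ nᵢ^(3 − ε). As each call
-- also takes one step, taking integer parts changes the total by a factor of
-- at most 2.
record SubcubicReduction (P Q : Problem) : Set where
  field
    program          : Program
    maxWord          : ℕ → ℕ
    maxWord-poly     : PolyBounded maxWord
    run              : ∀ x → Run Q (maxWord (size P x)) program (initial (encode P x))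
    correct          : ∀ x → reg (final (run x)) 0 ≡ answer P x
    subcubic         :
      ∀ ε → 0ℚ <ℚ ε → ∃[ ε′ ] 0ℚ <ℚ ε′ × ∃[ C ] ∃[ n₀ ] (∀ x → n₀ ≤ size P x →
        ∀ costs → Pointwise (λ nᵢ cᵢ → cᵢ ≤ 1 · nᵢ ^[3- ε ]) (queries (run x)) costs →
        (steps (run x) + sum costs) ≤ C · size P x ^[3- ε′ ])

-- Simple undirected graphs; `nothing` means that there is no edge.
record WeightedGraph (n : ℕ) : Set where
  field
    edge      : Fin n → Fin n → Maybe ℤ
    symmetric : ∀ i j → edge i j ≡ edge j i
    loopless  : ∀ i → edge i i ≡ nothing

open WeightedGraph public

triples : ∀ n → List (Fin n × Fin n × Fin n)
triples n = filter (λ (i , j , k) → (i Fin.<? j) ×-dec (j Fin.<? k))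
  (cartesianProduct (allFin n) (cartesianProduct (allFin n) (allFin n)))

triangleWeight : ∀ {n} → (Fin n → Fin n → Maybe ℤ) → Fin n × Fin n × Fin n → Maybe ℤ
triangleWeight w (i , j , k) = zipWith ℤ._+_ (zipWith ℤ._+_ (w i j) (w j k)) (w i k)

triangleWeights : ∀ {n} → WeightedGraph n → List ℤ
triangleWeights {n} G = mapMaybe (triangleWeight (edge G)) (triples n)

record Input (M : ℕ → ℕ) : Set where
  field
    vertices : ℕ
    graph    : WeightedGraph vertices
    bounded  : ∀ i j {w} → edge graph i j ≡ just w → ∣ w ∣ ≤ M vertices

open Input public

isEdge : Maybe ℤ → ℤ
isEdge nothing  = 0ℤ
isEdge (just _) = 1ℤ

weight : Maybe ℤ → ℤ
weight nothing  = 0ℤ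
weight (just w) = w

rowMajor : ∀ {n} → (Fin n → Fin n → ℤ) → List ℤ
rowMajor {n} f = tabulate (λ p → uncurry f (remQuot n p))

encodeGraph : ∀ {n} → WeightedGraph n → List ℤ
encodeGraph {n} G =
  + n ∷ rowMajor (λ i j → isEdge (edge G i j)) ++ rowMajor (λ i j → weight (edge G i j))

stored-++ˡ : ∀ {m b} xs {ys} → Stored m b (xs ++ ys) → Stored m b xs
stored-++ˡ []       _        = tt
stored-++ˡ (x ∷ xs) (e , st) = e , stored-++ˡ xs st

stored-++ʳ : ∀ {m b} xs {ys} → Stored m b (xs ++ ys) → Stored m (b + length xs) ys
stored-++ʳ {m} {b} []       {ys} st       = subst (λ a → Stored m a ys) (sym (ℕ.+-identityʳ b)) st
stored-++ʳ {m} {b} (x ∷ xs) {ys} (_ , st) =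
  subst (λ a → Stored m a ys) (sym (ℕ.+-suc b (length xs))) (stored-++ʳ xs st)

stored-tabulate : ∀ {m b n} (f : Fin n → ℤ) → Stored m b (tabulate f) →
                  ∀ i → m (b + toℕ i) ≡ f i
stored-tabulate {m} {b} f (e , _)  Fin.zero    = trans (cong m (ℕ.+-identityʳ b)) e
stored-tabulate {m} {b} f (_ , st) (Fin.suc i) =
  trans (cong m (ℕ.+-suc b (toℕ i))) (stored-tabulate (λ j → f (Fin.suc j)) st i)

stored-rowMajor : ∀ {m b n} (f : Fin n → Fin n → ℤ) → Stored m b (rowMajor f) →
                  ∀ i j → m (b + toℕ (combine i j)) ≡ f i j
stored-rowMajor f st i j =
  trans (stored-tabulate _ st (combine i j)) (cong (uncurry f) (Fin.remQuot-combine i j))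

edge-determined : ∀ {e e′} → isEdge e ≡ isEdge e′ → weight e ≡ weight e′ → e ≡ e′
edge-determined {nothing} {nothing} _  _ = refl
edge-determined {just _}  {just _}  _  w = cong just w
edge-determined {nothing} {just _}  ()
edge-determined {just _}  {nothing} ()

encodeGraph-determines : ∀ {m b n} (G H : WeightedGraph n) →
  Stored m b (encodeGraph G) → Stored m b (encodeGraph H) →
  ∀ i j → edge G i j ≡ edge H i j
encodeGraph-determines {m} {b} {n} G H (_ , g) (_ , h) i j = edge-determined
  (trans (sym (stored-rowMajor _ (stored-++ˡ (adj G) g) i j))
         (stored-rowMajor _ (stored-++ˡ (adj H) h) i j))
  (trans (sym (stored-rowMajor _ (wts G g) i j)) (stored-rowMajor _ (wts H h) i j))
  where
  adj : WeightedGraph n → List ℤ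
  adj K = rowMajor (λ i j → isEdge (edge K i j))

  wts : ∀ K → Stored m (suc b) (adj K ++ rowMajor (λ i j → weight (edge K i j))) →
        Stored m (suc b + n * n) (rowMajor (λ i j → weight (edge K i j)))
  wts K st = subst (λ l → Stored m (suc b + l) (rowMajor (λ i j → weight (edge K i j))))
    (length-tabulate {n = n * n} _) (stored-++ʳ (adj K) st)

triangleWeights-cong : ∀ {n} (G H : WeightedGraph n) →
  (∀ i j → edge G i j ≡ edge H i j) → triangleWeights G ≡ triangleWeights H
triangleWeights-cong {n} G H eq = mapMaybe-cong same (triples n)
  where
  same : ∀ t → triangleWeight (edge G) t ≡ triangleWeight (edge H) t
  same (i , j , k) rewrite eq i j | eq j k | eq i k = refl

numTriangles : ∀ {n} {P : Pred ℤ 0ℓ} → Decidable P → WeightedGraph n → ℕ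
numTriangles P? G = length (filter P? (triangleWeights G))

TriangleParity : {P : Pred ℤ 0ℓ} → Decidable P → (ℕ → ℕ) → Problem
TriangleParity P? M = record
  { Instance    = Input M
  ; size        = vertices
  ; encode      = λ x → encodeGraph (graph x)
  ; answer      = λ x → + (numTriangles P? (graph x) % 2)
  ; unambiguous = unamb
  }
  where
  unamb : ∀ {m b} (x y : Input M) →
          Stored m b (encodeGraph (graph x)) → Stored m b (encodeGraph (graph y)) →
          vertices x ≡ vertices y ×
          + (numTriangles P? (graph x) % 2) ≡ + (numTriangles P? (graph y) % 2)
  unamb x y sx sy = go (graph x) (graph y) (ℤ.+-injective (trans (sym (proj₁ sx)) (proj₁ sy))) sx sy
    where
    go : ∀ {m b n n′} (G : WeightedGraph n) (H : WeightedGraph n′) → n ≡ n′ →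
         Stored m b (encodeGraph G) → Stored m b (encodeGraph H) →
         n ≡ n′ × + (numTriangles P? G % 2) ≡ + (numTriangles P? H % 2)
    go G H refl g h = refl , cong (λ ws → + (length (filter P? ws) % 2))
      (triangleWeights-cong G H (encodeGraph-determines G H g h))

ZeroWeightTriangleParity : (ℕ → ℕ) → Problem
ZeroWeightTriangleParity = TriangleParity (ℤ._≟ 0ℤ)

NegativeWeightTriangleParity : (ℕ → ℕ) → Problem
NegativeWeightTriangleParity = TriangleParity (ℤ._<? 0ℤ)

{-# OPTIONS --safe #-}

-- An integer W satisfies W ≤ 0 iff 3W − 3 < 0, and 3W − 3 is the weight of a
-- triangle of weight W after replacing every edge weight w by 3w − 1. Hence the
-- zero weight triangles are counted by the difference of two negative weight
-- counts, on the graphs with weights 3w − 1 and w. As non-edges are stored with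
-- weight 0, the word 3 · weight − isEdge is correct for edges and non-edges
-- alike, and the adjacency part of the encoding is reused. Both queries have
-- size n and the rewriting takes O(n²) steps, so ε′ = min(ε, 1) works.

module Submission where

open import Defs
open import Data.Bool.Base using (true; false)
open import Data.Empty using (⊥-elim)
open import Data.Fin.Base as Fin using (Fin; toℕ; remQuot)
import Data.Fin.Properties as Fin
open import Data.Integer.Base as ℤ using (ℤ; +_; -[1+_]; 0ℤ; 1ℤ; ∣_∣; +<+)
import Data.Integer.Properties as ℤ
import Data.Integer.Tactic.RingSolver as ℤ-Solver
open import Data.List.Base using ([]; _∷_; _++_; length; filter; map; tabulate)
open import Data.List.Properties using (length-tabulate; map-mapMaybe; mapMaybe-cong)
open import Data.List.Relation.Binary.Pointwise.Base using (Pointwise; []; _∷_)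
open import Data.Maybe.Base as Maybe using (Maybe; just; nothing)
open import Data.Nat.Base
  using (ℕ; zero; suc; _+_; _*_; _^_; _∸_; _⊔_; _≤_; _<_; _%_; _≡ᵇ_; z≤n; s≤s; >-nonZero)
open import Data.Nat.DivMod using (%-distribˡ-+; m%n<n)
open import Data.Nat.ListAction using (sum)
import Data.Nat.Properties as ℕ
import Data.Nat.Tactic.RingSolver as ℕ-Solver
open import Data.Product using (_×_; _,_; ∃-syntax; proj₁; proj₂; uncurry)
open import Data.Rational.Base as ℚ using (0ℚ; 1ℚ; ↥_; ↧ₙ_)
open import Data.Sum.Base using (inj₁; inj₂)
open import Data.Unit.Base using (tt)
open import Function.Base using (_∘_)
open import Relation.Binary.PropositionalEquality

-- Polynomial bounds

-- The successor is for `n = 0`: there the power with exponent 0 is 1, while every higher power is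
-- 0.
^-monoʳ-≤-suc : ∀ n {k l} → k ≤ l → n ^ k ≤ suc (n ^ l)
^-monoʳ-≤-suc zero    {zero}  _   = s≤s z≤n
^-monoʳ-≤-suc zero    {suc _} _   = z≤n
^-monoʳ-≤-suc (suc n)         k≤l = ℕ.m≤n⇒m≤1+n (ℕ.^-monoʳ-≤ (suc n) k≤l)

polyBounded-+ : ∀ {f g} → PolyBounded f → PolyBounded g → PolyBounded (λ n → f n + g n)
polyBounded-+ {f} {g} (c , f≤) (d , g≤) = e , λ n → begin
  f n + g n                                        ≤⟨ ℕ.+-mono-≤ (f≤ n) (g≤ n) ⟩
  (c * n ^ c + c) + (d * n ^ d + d)                ≤⟨ ℕ.+-mono-≤
    (ℕ.+-monoˡ-≤ c (ℕ.*-monoʳ-≤ c (^-monoʳ-≤-suc n c≤e)))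
    (ℕ.+-monoˡ-≤ d (ℕ.*-monoʳ-≤ d (^-monoʳ-≤-suc n d≤e))) ⟩
  (c * suc (n ^ e) + c) + (d * suc (n ^ e) + d)    ≡⟨ collect c d (n ^ e) ⟩
  (c + d) * n ^ e + e                              ≤⟨ ℕ.+-monoˡ-≤ e (ℕ.*-monoˡ-≤ (n ^ e) c+d≤e) ⟩
  e * n ^ e + e                                    ∎
  where
  open ℕ.≤-Reasoning
  -- One `c + d` pays for the additive constants, the other for the `suc` from `^-monoʳ-≤-suc`.
  e = (c + d) + (c + d)

  c+d≤e : c + d ≤ e
  c+d≤e = ℕ.m≤m+n (c + d) (c + d)

  c≤e : c ≤ e
  c≤e = ℕ.≤-trans (ℕ.m≤m+n c d) c+d≤e

  d≤e : d ≤ e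
  d≤e = ℕ.≤-trans (ℕ.m≤n+m d c) c+d≤e

  collect : ∀ c d x → (c * suc x + c) + (d * suc x + d) ≡ (c + d) * x + ((c + d) + (c + d))
  collect = ℕ-Solver.solve-∀

polyBounded-const : ∀ k → PolyBounded (λ _ → k)
polyBounded-const k = k , λ n → ℕ.m≤n+m k (k * n ^ k)

polyBounded-square : PolyBounded (λ n → n * n)
polyBounded-square = 2 , λ n → begin
  n * n             ≤⟨ ℕ.m≤m+n (n * n) (n * n + 2) ⟩
  n * n + (n * n + 2) ≡⟨ expand n ⟩
  2 * n ^ 2 + 2     ∎
  where
  open ℕ.≤-Reasoning

  expand : ∀ n → n * n + (n * n + 2) ≡ 2 * (n * (n * 1)) + 2
  expand = ℕ-Solver.solve-∀

-- Bounds of the form C · n^(3 − ε)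

^-distribʳ-* : ∀ a b k → (a * b) ^ k ≡ a ^ k * b ^ k
^-distribʳ-* a b zero    = refl
^-distribʳ-* a b (suc k) = trans (cong (a * b *_) (^-distribʳ-* a b k)) (interchange a b (a ^ k) (b ^ k))
  where
  interchange : ∀ a b x y → a * b * (x * y) ≡ a * x * (b * y)
  interchange = ℕ-Solver.solve-∀

*-≤^ : ∀ {T C x n} ε → T ≤ C * x → x ≤ 1 · n ^[3- ε ] → T ≤ C · n ^[3- ε ]
*-≤^ {T} {C} {x} {n} ε T≤ x≤ = begin
  T ^ q                           ≤⟨ ℕ.^-monoˡ-≤ q T≤ ⟩
  (C * x) ^ q                     ≡⟨ ^-distribʳ-* C x q ⟩
  C ^ q * x ^ q                   ≤⟨ ℕ.*-monoʳ-≤ (C ^ q) x≤ ⟩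
  C ^ q * (1 ^ q * n ^ (3 * q ∸ ∣ ↥ ε ∣)) ≡⟨ cong (λ z → C ^ q * (z * n ^ (3 * q ∸ ∣ ↥ ε ∣))) (ℕ.^-zeroˡ q) ⟩
  C ^ q * (1 * n ^ (3 * q ∸ ∣ ↥ ε ∣))     ≡⟨ cong (C ^ q *_) (ℕ.*-identityˡ _) ⟩
  C ^ q * n ^ (3 * q ∸ ∣ ↥ ε ∣)           ∎
  where
  open ℕ.≤-Reasoning
  q = ↧ₙ ε

-- A maximum is one of its arguments, so the constant does not grow. Bounding a sum by a multiple of
-- the maximum avoids expanding the `q`-th power of a sum.
⊔-≤^ : ∀ {x y C n} ε → x ≤ C · n ^[3- ε ] → y ≤ C · n ^[3- ε ] → (x ⊔ y) ≤ C · n ^[3- ε ]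
⊔-≤^ {x} {y} ε x≤ y≤ with ℕ.⊔-sel x y
... | inj₁ eq rewrite eq = x≤
... | inj₂ eq rewrite eq = y≤

square^ : ∀ n q → (n * n) ^ q ≡ n ^ (2 * q)
square^ n q = trans (cong (λ z → (n * z) ^ q) (sym (ℕ.*-identityʳ n))) (ℕ.^-*-assoc n 2 q)

-- The last hypothesis says ε ≤ 1, so the exponent 3 - ε is at least 2.
square-≤^ : ∀ {n} ε → 1 ≤ n → ∣ ↥ ε ∣ ≤ ↧ₙ ε → (n * n) ≤ 1 · n ^[3- ε ]
square-≤^ {n} ε 1≤n p≤q = begin
  (n * n) ^ q               ≡⟨ square^ n q ⟩
  n ^ (2 * q)               ≤⟨ ℕ.^-monoʳ-≤ n {{>-nonZero 1≤n}} 2q≤3q-p ⟩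
  n ^ (3 * q ∸ p)           ≡⟨ ℕ.*-identityˡ _ ⟨
  1 * n ^ (3 * q ∸ p)       ≡⟨ cong (_* n ^ (3 * q ∸ p)) (ℕ.^-zeroˡ q) ⟨
  1 ^ q * n ^ (3 * q ∸ p)   ∎
  where
  open ℕ.≤-Reasoning
  p = ∣ ↥ ε ∣
  q = ↧ₙ ε

  2q≤3q-p : 2 * q ≤ 3 * q ∸ p
  2q≤3q-p = begin
    2 * q           ≡⟨ ℕ.m+n∸m≡n q (2 * q) ⟨
    3 * q ∸ q       ≤⟨ ℕ.∸-monoʳ-≤ (3 * q) p≤q ⟩
    3 * q ∸ p       ∎

-- For ε ≥ 1 the exponent is at most 2, also where the subtraction truncates. The `q`-th root is
-- taken by contradiction, from strict monotonicity of the `q`-th power.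
≤^⇒≤square : ∀ {c n} ε → 1 ≤ n → ↧ₙ ε ≤ ∣ ↥ ε ∣ → c ≤ 1 · n ^[3- ε ] → c ≤ n * n
≤^⇒≤square {c} {n} ε 1≤n q≤p c≤ =
  ℕ.≮⇒≥ λ n²<c → ℕ.<⇒≱ (ℕ.^-monoˡ-< q n²<c) (begin
    c ^ q                    ≤⟨ c≤ ⟩
    1 ^ q * n ^ (3 * q ∸ p)  ≡⟨ cong (_* n ^ (3 * q ∸ p)) (ℕ.^-zeroˡ q) ⟩
    1 * n ^ (3 * q ∸ p)      ≡⟨ ℕ.*-identityˡ _ ⟩
    n ^ (3 * q ∸ p)          ≤⟨ ℕ.^-monoʳ-≤ n {{>-nonZero 1≤n}} (ℕ.∸-monoʳ-≤ (3 * q) q≤p) ⟩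
    n ^ (3 * q ∸ q)          ≡⟨ cong (n ^_) (ℕ.m+n∸m≡n q (2 * q)) ⟩
    n ^ (2 * q)              ≡⟨ square^ n q ⟨
    (n * n) ^ q              ∎)
  where
  open ℕ.≤-Reasoning
  p = ∣ ↥ ε ∣
  q = ↧ₙ ε

-- The left side is the step count plus the cost of two queries of size `n`. As `n ≥ 1`, the summand
-- 10 is at most 10n², whence the constant 20 = 8 + 10 + 1 + 1.
quadratic+two-costs : ∀ ε → 0ℚ ℚ.< ε → ∃[ ε′ ] 0ℚ ℚ.< ε′ × (∀ {n} → 1 ≤ n →
  ∀ costs → Pointwise (λ nᵢ cᵢ → cᵢ ≤ 1 · nᵢ ^[3- ε ]) (n ∷ n ∷ []) costs →
  (8 * (n * n) + 10 + sum costs) ≤ 20 · n ^[3- ε′ ])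
quadratic+two-costs ε 0<ε with ℕ.≤-total (∣ ↥ ε ∣) (↧ₙ ε)
-- For ε ≤ 1 all of n², `c` and `d` are at most n^(3 - ε), hence so is their maximum.
... | inj₁ p≤q = ε , 0<ε , λ {n} 1≤n → λ { (c ∷ d ∷ []) (c≤ ∷ d≤ ∷ []) →
  *-≤^ {C = 20} {n * n ⊔ c ⊔ d} {n} ε (total 1≤n c d)
    (⊔-≤^ {n * n ⊔ c} {d} {1} {n} ε
      (⊔-≤^ {n * n} {c} {1} {n} ε (square-≤^ ε 1≤n p≤q) c≤) d≤) }
  where
  total : ∀ {n} → 1 ≤ n → ∀ c d → 8 * (n * n) + 10 + sum (c ∷ d ∷ []) ≤ 20 * (n * n ⊔ c ⊔ d)
  total {n} 1≤n c d = begin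
    8 * (n * n) + 10 + (c + (d + 0))      ≤⟨ ℕ.+-mono-≤
      (ℕ.+-mono-≤ (ℕ.*-monoʳ-≤ 8 n²≤x) (ℕ.*-monoʳ-≤ 10 (ℕ.≤-trans (ℕ.*-mono-≤ 1≤n 1≤n) n²≤x)))
      (ℕ.+-mono-≤ c≤x (ℕ.+-monoˡ-≤ 0 d≤x)) ⟩
    8 * x + 10 * x + (x + (x + 0))        ≡⟨ collect x ⟩
    20 * x                                ∎
    where
    open ℕ.≤-Reasoning
    x = n * n ⊔ c ⊔ d

    n²≤x : n * n ≤ x
    n²≤x = ℕ.≤-trans (ℕ.m≤m⊔n (n * n) c) (ℕ.m≤m⊔n (n * n ⊔ c) d)

    c≤x : c ≤ x
    c≤x = ℕ.≤-trans (ℕ.m≤n⊔m (n * n) c) (ℕ.m≤m⊔n (n * n ⊔ c) d)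

    d≤x : d ≤ x
    d≤x = ℕ.m≤n⊔m (n * n ⊔ c) d

    collect : ∀ x → 8 * x + 10 * x + (x + (x + 0)) ≡ 20 * x
    collect = ℕ-Solver.solve-∀
-- For ε ≥ 1 both costs are at most n², so the total is quadratic and the exponent 3 - 1 is enough.
... | inj₂ q≤p = 1ℚ , ℚ.*<* (+<+ (s≤s z≤n)) , λ {n} 1≤n → λ { (c ∷ d ∷ []) (c≤ ∷ d≤ ∷ []) →
  *-≤^ {C = 20} {n * n} {n} 1ℚ (total 1≤n c d (≤^⇒≤square ε 1≤n q≤p c≤) (≤^⇒≤square ε 1≤n q≤p d≤))
    (square-≤^ 1ℚ 1≤n ℕ.≤-refl) }
  where
  total : ∀ {n} → 1 ≤ n → ∀ c d → c ≤ n * n → d ≤ n * n →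
          8 * (n * n) + 10 + sum (c ∷ d ∷ []) ≤ 20 * (n * n)
  total {n} 1≤n c d c≤ d≤ = begin
    8 * (n * n) + 10 + (c + (d + 0))                ≤⟨ ℕ.+-mono-≤
      (ℕ.+-monoʳ-≤ (8 * (n * n)) (ℕ.*-monoʳ-≤ 10 (ℕ.*-mono-≤ 1≤n 1≤n)))
      (ℕ.+-mono-≤ c≤ (ℕ.+-monoˡ-≤ 0 d≤)) ⟩
    8 * (n * n) + 10 * (n * n) + (n * n + (n * n + 0)) ≡⟨ collect (n * n) ⟩
    20 * (n * n)                                     ∎
    where
    open ℕ.≤-Reasoning

    collect : ∀ x → 8 * x + 10 * x + (x + (x + 0)) ≡ 20 * x
    collect = ℕ-Solver.solve-∀

-- Counting triangles of weight at most 0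

shift : ℤ → ℤ
shift w = w ℤ.* + 3 ℤ.- 1ℤ

shiftedGraph : ∀ {n} → WeightedGraph n → WeightedGraph n
shiftedGraph G = record
  { edge      = λ i j → Maybe.map shift (edge G i j)
  ; symmetric = λ i j → cong (Maybe.map shift) (symmetric G i j)
  ; loopless  = λ i → cong (Maybe.map shift) (loopless G i)
  }

-- The factored form of 3w - 3 lets its sign be found by evaluation once `w` is known to be 0, 1, at
-- least 2, or negative.
tripleShift : ℤ → ℤ
tripleShift w = (w ℤ.- 1ℤ) ℤ.* + 3

triangleWeight-shift : ∀ {n} (G : WeightedGraph n) t →
  triangleWeight (edge (shiftedGraph G)) t ≡ Maybe.map tripleShift (triangleWeight (edge G) t)
triangleWeight-shift G (i , j , k) with edge G i j | edge G j k | edge G i k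
... | nothing | nothing | _       = refl
... | nothing | just _  | _       = refl
... | just _  | nothing | _       = refl
... | just _  | just _  | nothing = refl
... | just a  | just b  | just c  = cong just (sum-shift a b c)
  where
  sum-shift : ∀ a b c →
    (a ℤ.* + 3 ℤ.- 1ℤ) ℤ.+ (b ℤ.* + 3 ℤ.- 1ℤ) ℤ.+ (c ℤ.* + 3 ℤ.- 1ℤ) ≡
    (a ℤ.+ b ℤ.+ c ℤ.- 1ℤ) ℤ.* + 3
  sum-shift = ℤ-Solver.solve-∀

triangleWeights-shift : ∀ {n} (G : WeightedGraph n) →
  triangleWeights (shiftedGraph G) ≡ map tripleShift (triangleWeights G)
triangleWeights-shift {n} G = trans
  (mapMaybe-cong (triangleWeight-shift G) (triples n))
  (sym (map-mapMaybe tripleShift (triangleWeight (edge G)) (triples n)))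

-- Only the weight 0 becomes negative without having been so. The weight 1 is split off because its
-- image is 0, whereas larger weights have positive images.
count-shift : ∀ ws →
  length (filter (ℤ._<? 0ℤ) (map tripleShift ws)) ≡
  length (filter (ℤ._<? 0ℤ) ws) + length (filter (ℤ._≟ 0ℤ) ws)
count-shift [] = refl
count-shift (+ zero ∷ ws) = trans (cong suc (count-shift ws)) (sym (ℕ.+-suc _ _))
count-shift (+ 1 ∷ ws) = count-shift ws
count-shift (+ suc (suc _) ∷ ws) = count-shift ws
count-shift (-[1+ _ ] ∷ ws) = cong suc (count-shift ws)

numTriangles-shift : ∀ {n} (G : WeightedGraph n) →
  numTriangles (ℤ._<? 0ℤ) (shiftedGraph G) ≡
  numTriangles (ℤ._<? 0ℤ) G + numTriangles (ℤ._≟ 0ℤ) G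
numTriangles-shift G =
  trans (cong (length ∘ filter (ℤ._<? 0ℤ)) (triangleWeights-shift G)) (count-shift (triangleWeights G))

-- The difference `d` is -1, 0 or 1 and has the parity of `b`. Squaring removes the sign, so the
-- program gets by without a remainder operation.
square-%2-difference : ∀ a b → let d = + ((a + b) % 2) ℤ.- + (a % 2) in d ℤ.* d ≡ + (b % 2)
square-%2-difference a b rewrite %-distribˡ-+ a b 2 {{_}}
  with a % 2 | m%n<n a 2 | b % 2 | m%n<n b 2
... | 0 | _ | 0 | _ = refl
... | 0 | _ | 1 | _ = refl
... | 1 | _ | 0 | _ = refl
... | 1 | _ | 1 | _ = refl
... | suc (suc _) | s≤s (s≤s ()) | _ | _
... | _ | _ | suc (suc _) | s≤s (s≤s ())

weight-shift : ∀ e → weight e ℤ.* + 3 ℤ.- isEdge e ≡ weight (Maybe.map shift e)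
weight-shift nothing  = refl
weight-shift (just _) = refl

isEdge-shift : ∀ e → isEdge e ≡ isEdge (Maybe.map shift e)
isEdge-shift nothing  = refl
isEdge-shift (just _) = refl

∣isEdge∣≤1 : ∀ e → ∣ isEdge e ∣ ≤ 1
∣isEdge∣≤1 nothing  = z≤n
∣isEdge∣≤1 (just _) = ℕ.≤-refl

∣weight∣≤ : ∀ e {B} → (∀ {w} → e ≡ just w → ∣ w ∣ ≤ B) → ∣ weight e ∣ ≤ B
∣weight∣≤ nothing  _  = z≤n
∣weight∣≤ (just _) w≤ = w≤ refl

-- The subtrahend is left general to cover `shift` itself (1), the stored word (`isEdge`) and the
-- intermediate product (0).
∣shift∣≤ : ∀ w a {B} → ∣ w ∣ ≤ B → ∣ a ∣ ≤ 1 → ∣ w ℤ.* + 3 ℤ.- a ∣ ≤ 1 + 3 * B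
∣shift∣≤ w a {B} w≤ a≤ = begin
  ∣ w ℤ.* + 3 ℤ.- a ∣       ≤⟨ ℤ.∣i-j∣≤∣i∣+∣j∣ (w ℤ.* + 3) a ⟩
  ∣ w ℤ.* + 3 ∣ + ∣ a ∣     ≡⟨ cong (_+ ∣ a ∣) (ℤ.abs-* w (+ 3)) ⟩
  ∣ w ∣ * 3 + ∣ a ∣         ≤⟨ ℕ.+-mono-≤ (ℕ.*-monoˡ-≤ 3 w≤) a≤ ⟩
  B * 3 + 1                 ≡⟨ ℕ.+-comm (B * 3) 1 ⟩
  1 + B * 3                 ≡⟨ cong suc (ℕ.*-comm B 3) ⟩
  1 + 3 * B                 ∎
  where open ℕ.≤-Reasoning

shiftedInput : ∀ {M} → Input M → Input (λ n → 1 + 3 * M n)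
shiftedInput {M} x = record
  { vertices = vertices x
  ; graph    = shiftedGraph (graph x)
  ; bounded  = bounded′
  }
  where
  bounded′ : ∀ i j {w} → edge (shiftedGraph (graph x)) i j ≡ just w → ∣ w ∣ ≤ 1 + 3 * M (vertices x)
  bounded′ i j eq with edge (graph x) i j in e
  bounded′ i j refl | just w = ∣shift∣≤ w 1ℤ (bounded x i j e) ℕ.≤-refl

-- The first query is the unchanged graph, viewed as an instance under the larger weight bound of
-- the oracle.
relaxedInput : ∀ {M} → Input M → Input (λ n → 1 + 3 * M n)
relaxedInput {M} x = record
  { vertices = vertices x
  ; graph    = graph x
  ; bounded  = λ i j eq → ℕ.m≤n⇒m≤1+n (ℕ.≤-trans (bounded x i j eq) (ℕ.m≤m+n _ _))
  }

-- Memory contents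

stored-contents : ∀ ws {m} b → (∀ a → m (b + a) ≡ contents ws a) → Stored m b ws
stored-contents []       b eq = tt
stored-contents (w ∷ ws) {m} b eq =
  trans (cong m (sym (ℕ.+-identityʳ b))) (eq 0) ,
  stored-contents ws (suc b) (λ a → trans (cong m (sym (ℕ.+-suc b a))) (eq (suc a)))

store-++ : ∀ {m b} xs {ys} → Stored m b xs → Stored m (b + length xs) ys → Stored m b (xs ++ ys)
store-++ {m} {b} []       {ys} _        st = subst (λ a → Stored m a ys) (ℕ.+-identityʳ b) st
store-++ {m} {b} (x ∷ xs) {ys} (e , sx) st =
  e , store-++ xs sx (subst (λ a → Stored m a ys) (ℕ.+-suc b (length xs)) st)

store-tabulate : ∀ {m b n} (f : Fin n → ℤ) → (∀ i → m (b + toℕ i) ≡ f i) → Stored m b (tabulate f)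
store-tabulate {n = zero}  f eq = tt
store-tabulate {m} {b} {suc n} f eq =
  trans (cong m (sym (ℕ.+-identityʳ b))) (eq Fin.zero) ,
  store-tabulate (f ∘ Fin.suc) (λ i → trans (cong m (sym (ℕ.+-suc b (toℕ i)))) (eq (Fin.suc i)))

update-same : ∀ f k v → (f [ k ↦ v ]) k ≡ v
update-same f k v with k ≡ᵇ k | ℕ.≡⇒≡ᵇ k k refl
... | true | _ = refl

update-other : ∀ f k v {j} → j ≢ k → (f [ k ↦ v ]) j ≡ f j
update-other f k v {j} j≢k with j ≡ᵇ k | ℕ.≡ᵇ⇒≡ j k
... | true  | j≡k = ⊥-elim (j≢k (j≡k tt))
... | false | _   = refl

-- Memory layout of an encoded graph

module Layout {n} (G : WeightedGraph n) where

  entry : Fin (n * n) → Maybe ℤ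
  entry p = uncurry (edge G) (remQuot n p)

  isEdgeAt weightAt : Fin (n * n) → ℤ
  isEdgeAt = isEdge ∘ entry
  weightAt = weight ∘ entry

  -- Matrix entries are addressed by their row-major position, matching the single counter of the
  -- loop.
  record Encoded (m : Memory) : Set where
    field
      order     : m 0 ≡ + n
      adjacency : ∀ p → m (suc (toℕ p)) ≡ isEdgeAt p
      weights   : ∀ p → m (suc (toℕ p) + n * n) ≡ weightAt p

  open Encoded public

  shuffle : ∀ k → suc (n * n) + k ≡ suc k + n * n
  shuffle k = cong suc (ℕ.+-comm (n * n) k)

  stored⇒encoded : ∀ {m} → Stored m 0 (encodeGraph G) → Encoded m
  stored⇒encoded {m} (e , st) = record
    { order     = e
    ; adjacency = stored-tabulate isEdgeAt (stored-++ˡ (tabulate isEdgeAt) st)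
    ; weights   = λ p → trans (cong m (sym (shuffle (toℕ p))))
        (stored-tabulate weightAt
          (subst (λ l → Stored m (suc l) (tabulate weightAt)) (length-tabulate isEdgeAt)
            (stored-++ʳ (tabulate isEdgeAt) st)) p)
    }

  encoded⇒stored : ∀ {m} → Encoded m → Stored m 0 (encodeGraph G)
  encoded⇒stored {m} enc = order enc , store-++ (tabulate isEdgeAt)
    (store-tabulate isEdgeAt (adjacency enc))
    (subst (λ l → Stored m (suc l) (tabulate weightAt)) (sym (length-tabulate isEdgeAt))
      (store-tabulate weightAt (λ p → trans (cong m (shuffle (toℕ p))) (weights enc p))))

-- The program

-- Register 2 counts down from n², so that it is the address of an adjacency
-- word; the corresponding weight is n² words further on.
shiftWord : Program
shiftWord =
  load 6 2 ⨾ op add 7 2 3 ⨾ load 8 7 ⨾ op mul 8 8 4 ⨾ op sub 8 8 6 ⨾ store 7 8 ⨾ op sub 2 2 5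

-- Register 0 is initially 0, the address of the instance in both queries. Register 1 keeps the
-- first parity; registers 2 and 3 enter the loop holding n², as counter and as offset to the
-- weights.
parityProgram : Program
parityProgram =
  oracle 1 0 ⨾
  load 3 0 ⨾ op mul 2 3 3 ⨾ op mul 3 3 3 ⨾ const 4 (+ 3) ⨾ const 5 1ℤ ⨾
  while 2 shiftWord ⨾
  oracle 2 0 ⨾ op sub 2 2 1 ⨾ op mul 0 2 2

-- Execution of the loop

module Loop (Q : Problem) {W N B : ℕ} {m₀ : Memory} (ans : ℤ)
  (3≤W : 3 ≤ W) (2N≤W : N + N ≤ W) (3B<W : 1 + 3 * B ≤ W)
  (adj≤ : ∀ {k} → k < N → ∣ m₀ (suc k) ∣ ≤ 1) (wt≤ : ∀ {k} → k < N → ∣ m₀ (suc k + N) ∣ ≤ B)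
  where

  -- Weights are rewritten from the last position downwards, those from `c` on being done. The
  -- addresses up to `c + N` comprise the order, all adjacency words and the weights still to be
  -- read.
  record Inv (c : ℕ) (s : State) : Set where
    field
      c≤N       : c ≤ N
      reg0      : reg s 0 ≡ 0ℤ
      reg1      : reg s 1 ≡ ans
      reg2      : reg s 2 ≡ + c
      reg3      : reg s 3 ≡ + N
      reg4      : reg s 4 ≡ + 3
      reg5      : reg s 5 ≡ 1ℤ
      untouched : ∀ {a} → a ≤ c + N → mem s a ≡ m₀ a
      updated   : ∀ {k} → c ≤ k → k < N → mem s (suc k + N) ≡ m₀ (suc k + N) ℤ.* + 3 ℤ.- m₀ (suc k)

  exec-shiftWord : ∀ {c s} → Inv (suc c) s → ∃[ s′ ] Exec Q W shiftWord s s′ 7 [] × Inv c s′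
  exec-shiftWord {c} {s} inv =
    _ ,
    (load reg2 adjFits ⨾ op addrFits ⨾ load addr wtFits ⨾ op tripledFits ⨾ op newFits ⨾
     store addr newFits ⨾ op counterFits) ,
    record
      { c≤N       = ℕ.<⇒≤ c≤N
      ; reg0      = reg0
      ; reg1      = reg1
      ; reg2      = counter
      ; reg3      = reg3
      ; reg4      = reg4
      ; reg5      = reg5
      -- The word written lies at `suc c + N`, just above the new threshold.
      ; untouched = λ {a} a≤ → trans
          (update-other (mem s) (suc c + N) new (ℕ.<⇒≢ (s≤s a≤)))
          (untouched (ℕ.m≤n⇒m≤1+n a≤))
      ; updated   = updated′
      }
    where
    open Inv inv

    -- Phrased through `mem s` and `reg s 4`, as execution produces it; `new≡` supplies the intended
    -- value.
    new : ℤ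
    new = mem s (suc c + N) ℤ.* reg s 4 ℤ.- mem s (suc c)

    adj≡ : mem s (suc c) ≡ m₀ (suc c)
    adj≡ = untouched (ℕ.m≤m+n (suc c) N)

    wt≡ : mem s (suc c + N) ≡ m₀ (suc c + N)
    wt≡ = untouched ℕ.≤-refl

    tripled≡ : mem s (suc c + N) ℤ.* reg s 4 ≡ m₀ (suc c + N) ℤ.* + 3
    tripled≡ = cong₂ ℤ._*_ wt≡ reg4

    new≡ : new ≡ m₀ (suc c + N) ℤ.* + 3 ℤ.- m₀ (suc c)
    new≡ = cong₂ ℤ._-_ tripled≡ adj≡

    addr : reg s 2 ℤ.+ reg s 3 ≡ + (suc c + N)
    addr = cong₂ ℤ._+_ reg2 reg3

    counter : reg s 2 ℤ.- reg s 5 ≡ + c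
    counter = cong₂ ℤ._-_ reg2 reg5

    fits : ∀ {x y b} → x ≡ y → ∣ y ∣ ≤ b → b ≤ W → ∣ x ∣ ≤ W
    fits refl y≤ b≤ = ℕ.≤-trans y≤ b≤

    adjFits : ∣ mem s (suc c) ∣ ≤ W
    adjFits = fits adj≡ (adj≤ c≤N) (ℕ.≤-trans (s≤s z≤n) 3≤W)

    wtFits : ∣ mem s (suc c + N) ∣ ≤ W
    wtFits = fits wt≡ (wt≤ c≤N) (ℕ.≤-trans (ℕ.m≤n⇒m≤1+n (ℕ.m≤m+n B _)) 3B<W)

    tripledFits : ∣ mem s (suc c + N) ℤ.* reg s 4 ∣ ≤ W
    tripledFits = fits (trans tripled≡ (sym (ℤ.+-identityʳ _)))
      (∣shift∣≤ (m₀ (suc c + N)) 0ℤ (wt≤ c≤N) z≤n) 3B<W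

    newFits : ∣ new ∣ ≤ W
    newFits = fits new≡ (∣shift∣≤ (m₀ (suc c + N)) (m₀ (suc c)) (wt≤ c≤N) (adj≤ c≤N)) 3B<W

    addrFits : ∣ reg s 2 ℤ.+ reg s 3 ∣ ≤ W
    addrFits = fits addr (ℕ.+-monoˡ-≤ N c≤N) 2N≤W

    counterFits : ∣ reg s 2 ℤ.- reg s 5 ∣ ≤ W
    counterFits = fits counter (ℕ.≤-trans (ℕ.<⇒≤ c≤N) (ℕ.m≤m+n N N)) 2N≤W

    updated′ : ∀ {k} → c ≤ k → k < N →
      (mem s [ suc c + N ↦ new ]) (suc k + N) ≡ m₀ (suc k + N) ℤ.* + 3 ℤ.- m₀ (suc k)
    -- Positions above `c` were handled by earlier iterations; position `c` is the word just stored.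
    updated′ {k} c≤k k<N with ℕ.m≤n⇒m<n∨m≡n c≤k
    ... | inj₁ c<k  = trans
      (update-other (mem s) (suc c + N) new (ℕ.>⇒≢ (s≤s (ℕ.+-monoˡ-< N c<k))))
      (updated c<k k<N)
    ... | inj₂ refl = trans (update-same (mem s) (suc c + N) new) new≡

  -- Each round costs one test and seven instructions; the last summand is the failing test.
  exec-loop : ∀ {c s} → Inv c s → ∃[ s′ ] Exec Q W (while 2 shiftWord) s s′ (c * 8 + 1) [] × Inv 0 s′
  exec-loop {zero}  inv = _ , while-no (ℤ.≤-reflexive (Inv.reg2 inv)) , inv
  exec-loop {suc c} inv
    with _ , e , inv′ ← exec-shiftWord inv
    with _ , es , inv″ ← exec-loop inv′ =
    _ , while-yes (subst (0ℤ ℤ.<_) (sym (Inv.reg2 inv)) (+<+ (s≤s z≤n))) e es , inv″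

-- In `wordSize`, 2n² is the last address of the encoding and `oracleWeight` bounds the rewritten
-- weights. The 2, with the 1 inside `oracleWeight`, makes room for the constant 3.
oracleWeight wordSize : (ℕ → ℕ) → ℕ → ℕ
oracleWeight M n = 1 + 3 * M n
wordSize M n = 2 + (n * n + n * n) + oracleWeight M n

polyBounded-oracleWeight : ∀ {M} → PolyBounded M → PolyBounded (oracleWeight M)
polyBounded-oracleWeight M≤ = polyBounded-+ (polyBounded-const 1)
  -- `3 * M n` unfolds to `M n + (M n + (M n + 0))`.
  (polyBounded-+ M≤ (polyBounded-+ M≤ (polyBounded-+ M≤ (polyBounded-const 0))))

polyBounded-wordSize : ∀ {M} → PolyBounded M → PolyBounded (wordSize M)
polyBounded-wordSize M≤ = polyBounded-+
  (polyBounded-+ (polyBounded-const 2) (polyBounded-+ polyBounded-square polyBounded-square))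
  (polyBounded-oracleWeight M≤)

-- The run on a given input

module Execution {M : ℕ → ℕ} (x : Input M) where

  Q : Problem
  Q = NegativeWeightTriangleParity (oracleWeight M)

  n W : ℕ
  n = vertices x
  W = wordSize M n

  private
    module L  = Layout (graph x)
    module L′ = Layout (shiftedGraph (graph x))

  m₀ : Memory
  m₀ = contents (encodeGraph (graph x))

  stored₀ : Stored m₀ 0 (encodeGraph (graph x))
  stored₀ = stored-contents (encodeGraph (graph x)) 0 (λ _ → refl)

  encoded₀ : L.Encoded m₀
  encoded₀ = L.stored⇒encoded stored₀

  3≤W : 3 ≤ W
  3≤W = ℕ.+-mono-≤ {2} {_} {1} (s≤s (s≤s z≤n)) (s≤s z≤n)

  2n²≤W : n * n + n * n ≤ W
  2n²≤W = ℕ.≤-trans (ℕ.m≤n+m _ 2) (ℕ.m≤m+n _ _)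

  n²≤W : n * n ≤ W
  n²≤W = ℕ.≤-trans (ℕ.m≤m+n _ _) 2n²≤W

  n≤W : n ≤ W
  n≤W = ℕ.≤-trans (n≤n² n) n²≤W
    where
    n≤n² : ∀ n → n ≤ n * n
    n≤n² zero      = z≤n
    n≤n² n@(suc _) = ℕ.m≤m*n n n

  adj≤ : ∀ {k} → k < n * n → ∣ m₀ (suc k) ∣ ≤ 1
  adj≤ {k} k<n² = subst (λ a → ∣ m₀ (suc a) ∣ ≤ 1) (Fin.toℕ-fromℕ< k<n²)
    (subst (λ v → ∣ v ∣ ≤ 1) (sym (L.adjacency encoded₀ (Fin.fromℕ< k<n²))) (∣isEdge∣≤1 (L.entry (Fin.fromℕ< k<n²))))

  wt≤ : ∀ {k} → k < n * n → ∣ m₀ (suc k + n * n) ∣ ≤ M n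
  wt≤ {k} k<n² = subst (λ a → ∣ m₀ (suc a + n * n) ∣ ≤ M n) (Fin.toℕ-fromℕ< k<n²)
    (subst (λ v → ∣ v ∣ ≤ M n) (sym (L.weights encoded₀ (Fin.fromℕ< k<n²)))
      (∣weight∣≤ (L.entry (Fin.fromℕ< k<n²)) (bounded x _ _)))

  neg neg′ zeros : ℕ
  neg   = numTriangles (ℤ._<? 0ℤ) (graph x)
  neg′  = numTriangles (ℤ._<? 0ℤ) (shiftedGraph (graph x))
  zeros = numTriangles (ℤ._≟ 0ℤ) (graph x)

  parity≤1 : ∀ a → a % 2 ≤ 1
  parity≤1 a = ℕ.≤-pred (m%n<n a 2)

  parity≤W : ∀ a → a % 2 ≤ W
  parity≤W a = ℕ.≤-trans (parity≤1 a) (ℕ.≤-trans (s≤s z≤n) 3≤W)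

  open Loop Q {W} {n * n} {M n} {m₀} (+ (neg % 2)) 3≤W 2n²≤W (ℕ.m≤n+m (oracleWeight M n) (2 + (n * n + n * n))) adj≤ wt≤

  n²≡ : + n ℤ.* + n ≡ + (n * n)
  n²≡ = sym (ℤ.pos-* n n)

  n²fits : ∣ + n ℤ.* + n ∣ ≤ W
  n²fits = subst (λ v → ∣ v ∣ ≤ W) (sym n²≡) n²≤W

  -- The updates follow the setup instructions in order, so execution reaches this state by
  -- computation.
  afterSetup : State
  afterSetup = ⟨ (λ _ → 0ℤ) [ 1 ↦ + (neg % 2) ] [ 3 ↦ + n ] [ 2 ↦ + n ℤ.* + n ]
                   [ 3 ↦ + n ℤ.* + n ] [ 4 ↦ + 3 ] [ 5 ↦ 1ℤ ] , m₀ ⟩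

  inv₀ : Inv (n * n) afterSetup
  inv₀ = record
    { c≤N       = ℕ.≤-refl
    ; reg0      = refl
    ; reg1      = refl
    ; reg2      = n²≡
    ; reg3      = n²≡
    ; reg4      = refl
    ; reg5      = refl
    ; untouched = λ _ → refl
    ; updated   = λ n²≤k k<n² → ⊥-elim (ℕ.<⇒≱ k<n² n²≤k)
    }

  -- Shifting keeps the edge set, so order and adjacency words are the original ones; at `c = 0`
  -- every weight has been rewritten.
  stored-shifted : ∀ {s} → Inv 0 s → Stored (mem s) 0 (encodeGraph (shiftedGraph (graph x)))
  stored-shifted {s} inv = L′.encoded⇒stored (record
    { order     = untouched z≤n
    ; adjacency = λ p → trans (untouched (Fin.toℕ<n p))
        (trans (L.adjacency encoded₀ p) (isEdge-shift (L.entry p)))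
    ; weights   = λ p → trans (updated z≤n (Fin.toℕ<n p))
        (trans (cong₂ (λ w a → w ℤ.* + 3 ℤ.- a) (L.weights encoded₀ p) (L.adjacency encoded₀ p))
               (weight-shift (L.entry p)))
    })
    where open Inv inv

  loop = exec-loop inv₀
  afterLoop = proj₁ loop
  inv = proj₂ (proj₂ loop)

  difference : ℤ
  difference = + (neg′ % 2) ℤ.- reg afterLoop 1

  difference-squared : difference ℤ.* difference ≡ + (zeros % 2)
  difference-squared rewrite Inv.reg1 inv | numTriangles-shift (graph x) = square-%2-difference neg zeros

  difference-fits : ∣ difference ∣ ≤ W
  difference-fits rewrite Inv.reg1 inv = ℕ.≤-trans
    (ℤ.∣i-j∣≤∣i∣+∣j∣ (+ (neg′ % 2)) (+ (neg % 2)))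
    (ℕ.≤-trans (ℕ.+-mono-≤ (parity≤1 neg′) (parity≤1 neg)) (ℕ.≤-trans (ℕ.n≤1+n 2) 3≤W))

  parityRun : Run Q W parityProgram (initial (encodeGraph (graph x)))
  parityRun = record
    { final   = _
    ; steps   = _
    ; queries = n ∷ n ∷ []
    ; exec    =
        oracle (relaxedInput x) refl stored₀ (parity≤W neg) ⨾
        load refl n≤W ⨾ op n²fits ⨾ op n²fits ⨾
        const 3≤W ⨾ const (ℕ.≤-trans (s≤s z≤n) 3≤W) ⨾
        proj₁ (proj₂ loop) ⨾
        oracle (shiftedInput x) (Inv.reg0 inv) (stored-shifted inv) (parity≤W neg′) ⨾
        op difference-fits ⨾
        op (subst (λ v → ∣ v ∣ ≤ W) (sym difference-squared) (parity≤W zeros))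
    }

  -- Six instructions precede the loop and three follow it.
  steps≡ : steps parityRun ≡ 8 * (n * n) + 10
  steps≡ = count (n * n)
    where
    count : ∀ N → 6 + (N * 8 + 1 + 3) ≡ 8 * N + 10
    count = ℕ-Solver.solve-∀

theorem2 : (M : ℕ → ℕ) → PolyBounded M →
    ∃[ M′ ] PolyBounded M′ ×
    SubcubicReduction (ZeroWeightTriangleParity M) (NegativeWeightTriangleParity M′)
theorem2 M M≤ = oracleWeight M , polyBounded-oracleWeight M≤ , record
  { program      = parityProgram
  ; maxWord      = wordSize M
  ; maxWord-poly = polyBounded-wordSize M≤
  ; run          = Execution.parityRun
  -- Register 0 of the final state evaluates to the square of the difference of the two parities.
  ; correct      = Execution.difference-squared
  ; subcubic     = λ ε 0<ε → let ε′ , 0<ε′ , bound = quadratic+two-costs ε 0<ε in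
      -- The threshold `n₀` is 1 because the additive constant is absorbed by n² only for `n ≥ 1`.
      ε′ , 0<ε′ , 20 , 1 , λ x 1≤n costs costs≤ →
        subst (λ t → (t + sum costs) ≤ 20 · vertices x ^[3- ε′ ]) (sym (Execution.steps≡ x))
          (bound 1≤n costs costs≤)
  }
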